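{- For every unsatisfiable CNF formula $F$, $\mathrm{size}(F\vdash_{\mathrm{MaxResW}}\Box)\le 2\,\mathrm{size}(F\vdash_{\mathrm{TreeRes}}\Box)$.
   Context: $\mathrm{size}(F\vdash_P\Box)$ denotes the minimum size of a refutation of $F$ in the proof system $P$. Clauses are disjunctions of sets of literals with no complementary pair. $\Box$ is the empty clause. TreeRes (tree-like resolution): refutations using the resolution rule (from $C\vee x$ and $D\vee\overline{x}$ infer $C\vee D$), and optionally the weakening rule (from $C$ infer $C\vee x$), deriving $\Box$ from the clauses of $F$, where the underlying derivation graph is a tree (a clause used several times, including an axiom, must be rederived/relisted each time). The size is the number of clauses (nodes) in the tree. MaxSAT resolution rule: from $x\vee A$ and $\overline{x}\vee B$ with $A=a_1\vee\dots\vee a_s$, $B=b_1\vee\dots\vee b_t$, derive $A\vee B$; the clauses $x\vee A\vee b_1\vee\dots\vee b_{j-1}\vee\overline{b_j}$ for $1\le j\le t$; and the clauses $\overline{x}\vee B\vee a_1\vee\dots\vee a_{j-1}\vee\overline{a_j}$ for $1\le j\le s$. MaxSAT weakening rule: replace a clause $A$ by the two clauses $A\vee x$ and $A\vee\overline{x}$. When a rule is applied to a multi-set of clauses, (one copy of) each antecedent is removed and all non-tautologous consequents are added. A MaxResW refutation of $F$ is a sequence of multi-sets $F=F_0,F_1,\dots,F_s$, each obtained from the previous one by one application of the MaxSAT resolution rule or the MaxSAT weakening rule, with $\Box\in F_s$; its size is $s$. -}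

module Defs where

open import Data.Bool using (Bool; true; false)
open import Data.Fin using (Fin)
open import Data.Fin.Properties using (any?)
open import Data.Fin.Subset as Subset using (Subset)
open import Data.Fin.Subset.Properties using (_∈?_)
open import Data.List using (List; []; _∷_; _++_; foldr; filter)
open import Data.List.Membership.Propositional using (_∈_; _∉_)
open import Data.List.Relation.Binary.Permutation.Propositional using (_↭_)
open import Data.List.Relation.Unary.All using (All)
open import Data.List.Relation.Unary.Unique.Propositional using (Unique)
open import Data.Nat using (ℕ; suc; _+_; _≤_)
open import Data.Product using (_×_; ∃-syntax)
open import Relation.Binary.PropositionalEquality using (_≡_)
open import Relation.Nullary using (¬_; Dec; ¬?; _×-dec_)

private
  variable
    n : ℕ

data Literal (n : ℕ) : Set where
  pos neg : Fin n → Literal n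

negate : Literal n → Literal n
negate (pos x) = neg x
negate (neg x) = pos x

-- A disjunction of a set of literals over the variables Fin n, given by the
-- variables that occur positively and those that occur negatively. Equal sets
-- of literals are propositionally equal.
record Disj (n : ℕ) : Set where
  constructor ⟨_∣_⟩
  field
    positive negative : Subset n

open Disj public

infix 4 _∈ᴸ_ _∉ᴸ_

_∈ᴸ_ _∉ᴸ_ : Literal n → Disj n → Set
pos x ∈ᴸ C = x Subset.∈ positive C
neg x ∈ᴸ C = x Subset.∈ negative C
l ∉ᴸ C = ¬ (l ∈ᴸ C)

□ : Disj n
□ = ⟨ Subset.⊥ ∣ Subset.⊥ ⟩

lit : Literal n → Disj n
lit (pos x) = ⟨ Subset.⁅ x ⁆ ∣ Subset.⊥ ⟩
lit (neg x) = ⟨ Subset.⊥ ∣ Subset.⁅ x ⁆ ⟩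

infixr 6 _∨_

_∨_ : Disj n → Disj n → Disj n
C ∨ D = ⟨ positive C Subset.∪ positive D ∣ negative C Subset.∪ negative D ⟩

⋁ : List (Literal n) → Disj n
⋁ = foldr (λ l C → lit l ∨ C) □

Tautologous : Disj n → Set
Tautologous C = ∃[ x ] pos x ∈ᴸ C × neg x ∈ᴸ C

IsClause : Disj n → Set
IsClause C = ¬ Tautologous C

isClause? : (C : Disj n) → Dec (IsClause C)
isClause? C = ¬? (any? λ x → (x ∈? positive C) ×-dec (x ∈? negative C))

-- Lists of clauses stand for multisets: they are compared up to _↭_ below.
IsCNF : List (Disj n) → Set
IsCNF = All IsClause

Assignment : ℕ → Set
Assignment n = Fin n → Bool

_⊨ˡ_ : Assignment n → Literal n → Set
v ⊨ˡ pos x = v x ≡ true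
v ⊨ˡ neg x = v x ≡ false

_⊨_ : Assignment n → Disj n → Set
v ⊨ C = ∃[ l ] l ∈ᴸ C × v ⊨ˡ l

Unsatisfiable : List (Disj n) → Set
Unsatisfiable F = ∀ v → ¬ All (v ⊨_) F

-- TreeRes F C is the type of tree-like derivations of C from F. Writing a
-- premise as C ∨ x presupposes that the literal x does not occur in C, and
-- every line must be a clause, so tautologous conclusions are excluded.
data TreeRes (F : List (Disj n)) : Disj n → Set where
  axiom   : ∀ {C} → C ∈ F → TreeRes F C
  resolve : ∀ {C D} x → pos x ∉ᴸ C → neg x ∉ᴸ D → IsClause (C ∨ D) →
            TreeRes F (C ∨ lit (pos x)) → TreeRes F (D ∨ lit (neg x)) →
            TreeRes F (C ∨ D)
  weaken  : ∀ {C} l → IsClause (C ∨ lit l) →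
            TreeRes F C → TreeRes F (C ∨ lit l)

nodes : ∀ {F : List (Disj n)} {C} → TreeRes F C → ℕ
nodes (axiom _)             = 1
nodes (resolve _ _ _ _ S T) = suc (nodes S + nodes T)
nodes (weaken _ _ T)        = suc (nodes T)

-- chain C (b₁ ∷ … ∷ bₜ ∷ []) lists C ∨ b₁ ∨ … ∨ bⱼ₋₁ ∨ b̄ⱼ for 1 ≤ j ≤ t.
chain : Disj n → List (Literal n) → List (Disj n)
chain C []       = []
chain C (b ∷ bs) = (C ∨ lit (negate b)) ∷ chain (C ∨ lit b) bs

-- Antecedents and consequents of the two MaxSAT rules, before tautologies are
-- discarded. The consequents of resolution depend on how the literals of A and
-- of B are enumerated; every enumeration is allowed.
data MaxSATRule {n : ℕ} : List (Disj n) → List (Disj n) → Set where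
  resolution : ∀ x as bs → Unique as → Unique bs → pos x ∉ as → neg x ∉ bs →
    let A = ⋁ as; B = ⋁ bs in
    MaxSATRule ((lit (pos x) ∨ A) ∷ (lit (neg x) ∨ B) ∷ [])
               ((A ∨ B) ∷ chain (lit (pos x) ∨ A) bs
                       ++ chain (lit (neg x) ∨ B) as)
  weakening  : ∀ A x →
    MaxSATRule (A ∷ []) ((A ∨ lit (pos x)) ∷ (A ∨ lit (neg x)) ∷ [])

infix 4 _⟶_

data _⟶_ {n : ℕ} (Γ Δ : List (Disj n)) : Set where
  apply : ∀ {antecedents consequents} Θ →
          MaxSATRule antecedents consequents →
          Γ ↭ antecedents ++ Θ →
          Δ ↭ filter isClause? consequents ++ Θ →
          Γ ⟶ Δ

data MaxResW {n : ℕ} (Γ : List (Disj n)) : Set where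
  stop : □ ∈ Γ → MaxResW Γ
  step : ∀ {Δ} → Γ ⟶ Δ → MaxResW Δ → MaxResW Γ

steps : ∀ {Γ : List (Disj n)} → MaxResW Γ → ℕ
steps (stop _)   = 0
steps (step _ R) = suc (steps R)

IsMinimum : {Refutation : Set} → (Refutation → ℕ) → ℕ → Set
IsMinimum size k = (∃[ R ] size R ≡ k) × (∀ R → k ≤ size R)

-- IsMaxResWSize F k and IsTreeResSize F k say that the minimum refutation size
-- of F in the respective system exists and is k; k is then unique.
IsMaxResWSize IsTreeResSize : List (Disj n) → ℕ → Set
IsMaxResWSize F = IsMinimum (steps {Γ = F})
IsTreeResSize F = IsMinimum (nodes {F = F} {C = □})

{-# OPTIONS --safe #-}
module Submission where

-- A tree-like refutation is read as a decision tree: a path clause P, starting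
-- at □, is extended at each resolution by the literal contributed by the chosen
-- premise, and every leaf holds an axiom contained in its path clause. The
-- MaxSAT rules consume an axiom, so it is passed down the tree from the root
-- and, at each query on x with leaves of that axiom on both sides, weakened to
-- a copy with x and a copy with x̄. After that all the resolutions can be
-- performed bottom-up. There are fewer weakenings than leaves and fewer
-- resolutions than leaves. The minima exist because derivations of a given size
-- can be searched exhaustively and tree-like resolution is complete.

open import Data.Bool using (true; false; if_then_else_)
import Data.Bool.Properties as Bool
open import Data.Empty using (⊥-elim)
open import Data.Fin using (Fin; zero; suc; toℕ; fromℕ<)
open import Data.Fin.Properties using (any?; toℕ-fromℕ<; toℕ≤pred[n])
import Data.Fin.Properties as Fin
open import Data.Fin.Subset as Subset using (Subset; ∣_∣; ⁅_⁆; _∪_; _∩_; ∁)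
open import Data.Fin.Subset.Properties
  using (_∈?_; ∉⊥; x∈⁅x⁆; x∈⁅y⁆⇒x≡y
        ; ∣⁅x⁆∣≡1; ⊆-antisym; ∪-comm; x∈p∪q⁻; x∈p∪q⁺; anySubset?)
open import Data.List using (List; []; _∷_; _++_; [_]; length; lookup; filter; map; allFin)
open import Data.List.Membership.Propositional using (_∈_; _∉_)
open import Data.List.Membership.Propositional.Properties
  using (∈-++⁺ˡ; ∈-++⁺ʳ; ∈-map⁺; ∈-map⁻; ∈-allFin; ∈-filter⁺; ∈-filter⁻
        ; ∈-∃++; ∈-lookup)
open import Data.List.Properties using (filter-accept)
open import Data.List.Relation.Binary.Permutation.Propositional
  using (_↭_; prep; ↭-swap; ↭-refl; ↭-sym; ↭-trans; ↭-reflexive)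
open import Data.List.Relation.Binary.Permutation.Propositional.Properties
  using (++⁺ˡ; ++⁺ʳ; ++-comm; ++-assoc; shift; drop-∷; ∈-resp-↭; ↭-length)
import Data.List.Relation.Unary.All as All using (lookup)
open import Data.List.Relation.Unary.All.Properties using (¬All⇒Any¬)
open import Data.List.Relation.Unary.AllPairs using ([]; _∷_)
open import Data.List.Relation.Unary.Any using (Any; here; there; index)
import Data.List.Relation.Unary.Any as Any using (any?)
open import Data.List.Relation.Unary.Any.Properties using (lookup-index)
open import Data.List.Relation.Unary.Unique.Propositional using (Unique)
import Data.List.Relation.Unary.Unique.DecPropositional as UniqueDec
import Data.List.Relation.Unary.Unique.Propositional.Properties as Unique
open import Data.Nat using (ℕ; zero; suc; _+_; _*_; _∸_; _≤_; _<_; z≤n; s≤s)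
open import Data.Nat.Induction using (<-wellFounded; Acc; acc)
open import Data.Nat.Properties as ℕ using (anyUpTo?; ≮⇒≥; ≤-refl; ≤-trans)
open import Data.Product using (_×_; _,_; proj₁; proj₂; ∃; ∃-syntax; uncurry)
open import Data.Sum using (_⊎_; inj₁; inj₂; [_,_]′)
import Data.Sum as Sum
import Data.Vec as Vec using (lookup; here; there)
open import Data.Vec.Base using ([]; _∷_)
open import Data.Vec.Properties using ([]=⇒lookup; lookup⇒[]=)
import Data.Vec.Properties as Vec
open import Data.Nat.Tactic.RingSolver using (solve-∀)
open import Defs
open import Function using (_∘_; id; case_of_)
open import Relation.Binary.Definitions using (DecidableEquality)
open import Relation.Binary.PropositionalEquality
  using (_≡_; _≢_; refl; sym; cong; cong₂; subst) renaming (trans to ≡-trans)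
open import Relation.Nullary using (¬_; Dec; yes; no; ¬?; _×-dec_; _⊎-dec_; contradiction)
open import Relation.Nullary.Decidable using (map′)
open import Relation.Unary using (Decidable)

private
  variable
    m n k k′ : ℕ
    A C D P : Disj n
    Γ Δ Ε : List (Disj n)

-- Literals and disjunctions

pos-injective : ∀ {x y : Fin n} → pos x ≡ pos y → x ≡ y
pos-injective refl = refl

neg-injective : ∀ {x y : Fin n} → neg x ≡ neg y → x ≡ y
neg-injective refl = refl

infix 4 _≟ᴸ_ _≟ᴰ_ _∈ᴸ?_ _⊑_

_≟ᴸ_ : DecidableEquality (Literal n)
pos x ≟ᴸ pos y = map′ (cong pos) pos-injective (x Fin.≟ y)
pos x ≟ᴸ neg y = no λ ()
neg x ≟ᴸ pos y = no λ ()
neg x ≟ᴸ neg y = map′ (cong neg) neg-injective (x Fin.≟ y)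

_≟ᴰ_ : DecidableEquality (Disj n)
⟨ p ∣ q ⟩ ≟ᴰ ⟨ p′ ∣ q′ ⟩ =
  map′ (uncurry (cong₂ ⟨_∣_⟩)) (λ { refl → refl , refl })
       (Vec.≡-dec Bool._≟_ p p′ ×-dec Vec.≡-dec Bool._≟_ q q′)

_∈ᴸ?_ : ∀ l (C : Disj n) → Dec (l ∈ᴸ C)
pos x ∈ᴸ? C = x ∈? positive C
neg x ∈ᴸ? C = x ∈? negative C

_⊑_ : Disj n → Disj n → Set
C ⊑ D = ∀ l → l ∈ᴸ C → l ∈ᴸ D

⊑-antisym : C ⊑ D → D ⊑ C → C ≡ D
⊑-antisym C⊑D D⊑C =
  cong₂ ⟨_∣_⟩ (⊆-antisym (C⊑D (pos _)) (D⊑C (pos _)))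
              (⊆-antisym (C⊑D (neg _)) (D⊑C (neg _)))

∉□ : ∀ (l : Literal n) → l ∉ᴸ □
∉□ (pos x) = ∉⊥
∉□ (neg x) = ∉⊥

⊑□⇒≡□ : C ⊑ □ → C ≡ □
⊑□⇒≡□ C⊑□ = ⊑-antisym C⊑□ λ l l∈□ → contradiction l∈□ (∉□ l)

∈-∨⁻ : ∀ l (C D : Disj n) → l ∈ᴸ C ∨ D → l ∈ᴸ C ⊎ l ∈ᴸ D
∈-∨⁻ (pos x) C D = x∈p∪q⁻ (positive C) (positive D)
∈-∨⁻ (neg x) C D = x∈p∪q⁻ (negative C) (negative D)

∈-∨⁺ : ∀ l (C D : Disj n) → l ∈ᴸ C ⊎ l ∈ᴸ D → l ∈ᴸ C ∨ D
∈-∨⁺ (pos x) C D = x∈p∪q⁺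
∈-∨⁺ (neg x) C D = x∈p∪q⁺

∈-lit⁻ : ∀ l (k : Literal n) → l ∈ᴸ lit k → l ≡ k
∈-lit⁻ (pos x) (pos y) = cong pos ∘ x∈⁅y⁆⇒x≡y y
∈-lit⁻ (pos x) (neg y) = ⊥-elim ∘ ∉⊥
∈-lit⁻ (neg x) (pos y) = ⊥-elim ∘ ∉⊥
∈-lit⁻ (neg x) (neg y) = cong neg ∘ x∈⁅y⁆⇒x≡y y

∈-lit⁺ : ∀ (l : Literal n) → l ∈ᴸ lit l
∈-lit⁺ (pos x) = x∈⁅x⁆ x
∈-lit⁺ (neg x) = x∈⁅x⁆ x

⊑-∨ˡ : ∀ (C D : Disj n) → C ⊑ C ∨ D
⊑-∨ˡ C D l = ∈-∨⁺ l C D ∘ inj₁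

⊑-∨ʳ : ∀ (C D : Disj n) → D ⊑ C ∨ D
⊑-∨ʳ C D l = ∈-∨⁺ l C D ∘ inj₂

∨-lub : C ⊑ P → D ⊑ P → C ∨ D ⊑ P
∨-lub {C = C} {D = D} C⊑P D⊑P l = [ C⊑P l , D⊑P l ]′ ∘ ∈-∨⁻ l C D

lit-⊑ : ∀ l → l ∈ᴸ P → lit l ⊑ P
lit-⊑ {P = P} l l∈P l′ l′∈l = subst (_∈ᴸ P) (sym (∈-lit⁻ l′ l l′∈l)) l∈P

∈-∨lit : ∀ (P : Disj n) l → l ∈ᴸ P ∨ lit l
∈-∨lit P l = ⊑-∨ʳ P (lit l) l (∈-lit⁺ l)

∨lit-mono : ∀ l → A ⊑ P → A ∨ lit l ⊑ P ∨ lit l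
∨lit-mono {P = P} l A⊑P = ∨-lub (λ l′ → ⊑-∨ˡ P (lit l) l′ ∘ A⊑P l′) (⊑-∨ʳ P (lit l))

∨-comm : ∀ (C D : Disj n) → C ∨ D ≡ D ∨ C
∨-comm C D = cong₂ ⟨_∣_⟩ (∪-comm (positive C) (positive D)) (∪-comm (negative C) (negative D))

⊑-drop : ∀ l → l ∉ᴸ C → C ⊑ P ∨ lit l → C ⊑ P
⊑-drop {C = C} {P = P} l l∉C C⊑ l′ l′∈C with ∈-∨⁻ l′ P (lit l) (C⊑ l′ l′∈C)
... | inj₁ l′∈P = l′∈P
... | inj₂ l′∈l = contradiction (subst (_∈ᴸ C) (∈-lit⁻ l′ l l′∈l) l′∈C) l∉C

IsClause-antitone : C ⊑ D → IsClause D → IsClause C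
IsClause-antitone C⊑D D-clause (x , p , q) = D-clause (x , C⊑D (pos x) p , C⊑D (neg x) q)

IsClause-∨lit : ∀ l → negate l ∉ᴸ C → IsClause C → IsClause (C ∨ lit l)
IsClause-∨lit {C = C} (pos y) ¬l∉C C-clause (x , p , q)
  with ∈-∨⁻ (pos x) C (lit (pos y)) p | ∈-∨⁻ (neg x) C (lit (pos y)) q
... | _       | inj₂ q′ = contradiction q′ ∉⊥
... | inj₁ p′ | inj₁ q′ = C-clause (x , p′ , q′)
... | inj₂ p′ | inj₁ q′ = ¬l∉C (subst (λ z → neg z ∈ᴸ C) (x∈⁅y⁆⇒x≡y y p′) q′)
IsClause-∨lit {C = C} (neg y) ¬l∉C C-clause (x , p , q)
  with ∈-∨⁻ (pos x) C (lit (neg y)) p | ∈-∨⁻ (neg x) C (lit (neg y)) q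
... | inj₂ p′ | _       = contradiction p′ ∉⊥
... | inj₁ p′ | inj₁ q′ = C-clause (x , p′ , q′)
... | inj₁ p′ | inj₂ q′ = ¬l∉C (subst (λ z → pos z ∈ᴸ C) (x∈⁅y⁆⇒x≡y y q′) p′)

literals : ∀ n → List (Literal n)
literals n = map pos (allFin n) ++ map neg (allFin n)

∈-literals : ∀ (l : Literal n) → l ∈ literals n
∈-literals (pos x) = ∈-++⁺ˡ (∈-map⁺ pos (∈-allFin x))
∈-literals (neg x) = ∈-++⁺ʳ (map pos (allFin _)) (∈-map⁺ neg (∈-allFin x))

literals-unique : ∀ n → Unique (literals n)
literals-unique n =
  Unique.++⁺ (Unique.map⁺ pos-injective (Unique.allFin⁺ n))
             (Unique.map⁺ neg-injective (Unique.allFin⁺ n))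
             λ { (p , q) → case ∈-map⁻ pos p , ∈-map⁻ neg q of
                 λ { ((_ , _ , refl) , (_ , _ , ())) } }

∈-⋁⁻ : ∀ l (ls : List (Literal n)) → l ∈ᴸ ⋁ ls → l ∈ ls
∈-⋁⁻ l []       l∈ = contradiction l∈ (∉□ l)
∈-⋁⁻ l (k ∷ ls) l∈ with ∈-∨⁻ l (lit k) (⋁ ls) l∈
... | inj₁ p = here (∈-lit⁻ l k p)
... | inj₂ p = there (∈-⋁⁻ l ls p)

∈-⋁⁺ : ∀ l (ls : List (Literal n)) → l ∈ ls → l ∈ᴸ ⋁ ls
∈-⋁⁺ l (l ∷ ls) (here refl) = ⊑-∨ˡ (lit l) (⋁ ls) l (∈-lit⁺ l)
∈-⋁⁺ l (k ∷ ls) (there p)   = ⊑-∨ʳ (lit k) (⋁ ls) l (∈-⋁⁺ l ls p)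

module _ (l : Literal n) (C : Disj n) where

  private
    other? : ∀ l′ → Dec (l′ ∈ᴸ C × l′ ≢ l)
    other? l′ = (l′ ∈ᴸ? C) ×-dec ¬? (l′ ≟ᴸ l)

  -- `MaxSATRule` takes side clauses as duplicate-free lists; filtering one fixed enumeration yields
  -- such a list for any clause.
  others : List (Literal n)
  others = filter other? (literals n)

  others-unique : Unique others
  others-unique = Unique.filter⁺ other? (literals-unique n)

  ∉-others : l ∉ others
  ∉-others l∈ = proj₂ (proj₂ (∈-filter⁻ other? {xs = literals n} l∈)) refl

  ∉ᴸ-others : l ∉ᴸ ⋁ others
  ∉ᴸ-others = ∉-others ∘ ∈-⋁⁻ l others

  others-⊑ : ⋁ others ⊑ C
  others-⊑ l′ l′∈ =
    proj₁ (proj₂ (∈-filter⁻ other? {xs = literals n} (∈-⋁⁻ l′ others l′∈)))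

  lit-∨-others : l ∈ᴸ C → lit l ∨ ⋁ others ≡ C
  lit-∨-others l∈C = ⊑-antisym (∨-lub (lit-⊑ l l∈C) others-⊑) λ l′ l′∈C →
    ∈-∨⁺ l′ (lit l) (⋁ others) (case l′ ≟ᴸ l of λ where
      (yes refl) → inj₁ (∈-lit⁺ l)
      (no l′≢l)  → inj₂ (∈-⋁⁺ l′ others
                          (∈-filter⁺ other? (∈-literals l′) (l′∈C , l′≢l))))

  others-∨-lit : l ∈ᴸ C → ⋁ others ∨ lit l ≡ C
  others-∨-lit l∈C = ≡-trans (∨-comm (⋁ others) (lit l)) (lit-∨-others l∈C)

  others-⊑-drop : ∀ {P} → C ⊑ P ∨ lit l → ⋁ others ⊑ P
  others-⊑-drop C⊑ = ⊑-drop l ∉ᴸ-others λ l′ → C⊑ l′ ∘ others-⊑ l′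

-- Runs of the MaxSAT rules

infix 4 _⟶[_]_
infixr 5 _◅_

-- `done` holds a permutation, not an equality, so reordering the clauses costs no step.
data _⟶[_]_ {n : ℕ} : List (Disj n) → ℕ → List (Disj n) → Set where
  done : Γ ↭ Δ → Γ ⟶[ 0 ] Δ
  _◅_  : Γ ⟶ Δ → Δ ⟶[ k ] Ε → Γ ⟶[ suc k ] Ε

⟶-respˡ : Γ ↭ Δ → Δ ⟶ Ε → Γ ⟶ Ε
⟶-respˡ Γ↭Δ (apply Θ rule Δ↭ Ε↭) = apply Θ rule (↭-trans Γ↭Δ Δ↭) Ε↭

⟶-frame : ∀ Θ → Γ ⟶ Δ → Γ ++ Θ ⟶ Δ ++ Θ
⟶-frame Θ (apply {as} {cs} Ξ rule Γ↭ Δ↭) =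
  apply (Ξ ++ Θ) rule (↭-trans (++⁺ʳ Θ Γ↭) (++-assoc as Ξ Θ))
        (↭-trans (++⁺ʳ Θ Δ↭) (++-assoc (filter isClause? cs) Ξ Θ))

run-respˡ : Γ ↭ Δ → Δ ⟶[ k ] Ε → Γ ⟶[ k ] Ε
run-respˡ Γ↭Δ (done Δ↭Ε) = done (↭-trans Γ↭Δ Δ↭Ε)
run-respˡ Γ↭Δ (s ◅ r)    = ⟶-respˡ Γ↭Δ s ◅ r

run-respʳ : Γ ⟶[ k ] Δ → Δ ↭ Ε → Γ ⟶[ k ] Ε
run-respʳ (done Γ↭Δ) Δ↭Ε = done (↭-trans Γ↭Δ Δ↭Ε)
run-respʳ (s ◅ r)    Δ↭Ε = s ◅ run-respʳ r Δ↭Ε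

run-trans : Γ ⟶[ k ] Δ → Δ ⟶[ k′ ] Ε → Γ ⟶[ k + k′ ] Ε
run-trans (done Γ↭Δ) r′ = run-respˡ Γ↭Δ r′
run-trans (s ◅ r)    r′ = s ◅ run-trans r r′

run-frameʳ : ∀ Θ → Γ ⟶[ k ] Δ → Γ ++ Θ ⟶[ k ] Δ ++ Θ
run-frameʳ Θ (done Γ↭Δ) = done (++⁺ʳ Θ Γ↭Δ)
run-frameʳ Θ (s ◅ r)    = ⟶-frame Θ s ◅ run-frameʳ Θ r

run-frameˡ : ∀ Θ → Γ ⟶[ k ] Δ → Θ ++ Γ ⟶[ k ] Θ ++ Δ
run-frameˡ {Γ = Γ} {Δ = Δ} Θ r =
  run-respʳ (run-respˡ (++-comm Θ Γ) (run-frameʳ Θ r)) (++-comm Δ Θ)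

refutation : Γ ⟶[ k ] Δ → □ ∈ Δ → ∃[ R ] steps {Γ = Γ} R ≡ k
refutation (done Γ↭Δ) □∈Δ = stop (∈-resp-↭ (↭-sym Γ↭Δ) □∈Δ) , refl
refutation (s ◅ r)    □∈Δ with R , eq ← refutation r □∈Δ = step s R , cong suc eq

weakening-step : ∀ (A : Disj n) x Θ →
  IsClause (A ∨ lit (pos x)) → IsClause (A ∨ lit (neg x)) →
  A ∷ Θ ⟶ (A ∨ lit (pos x)) ∷ (A ∨ lit (neg x)) ∷ Θ
weakening-step A x Θ c₁ c₂ =
  apply Θ (weakening A x) ↭-refl (↭-reflexive (sym (cong (_++ Θ)
    (≡-trans (filter-accept isClause? c₁) (cong ((A ∨ lit (pos x)) ∷_) (filter-accept isClause? c₂))))))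

-- No step is needed when a premise already fits P.
resolution-run : ∀ {P : Disj n} {C D} x Θ → IsClause P →
  C ⊑ P ∨ lit (pos x) → D ⊑ P ∨ lit (neg x) →
  ∃[ k ] k ≤ 1 × ∃[ E ] E ⊑ P × ∃[ Δ ] (C ∷ D ∷ Θ ⟶[ k ] E ∷ Δ)
resolution-run {P = P} {C} {D} x Θ P-clause C⊑ D⊑ with pos x ∈ᴸ? C | neg x ∈ᴸ? D
... | no x∉C | _ = 0 , z≤n , C , ⊑-drop (pos x) x∉C C⊑ , D ∷ Θ , done ↭-refl
... | _ | no x∉D =
  0 , z≤n , D , ⊑-drop (neg x) x∉D D⊑ , C ∷ Θ , done (↭-swap C D ↭-refl)
... | yes x∈C | yes x∈D =
  -- The resolvent lies within `P`, so it is no tautology and `filter` keeps it at the head. The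
  -- other surviving consequents go into `Δ`.
  1 , ≤-refl , ⋁ as ∨ ⋁ bs , resolvent⊑P , _ ,
  apply Θ (resolution x as bs (others-unique (pos x) C) (others-unique (neg x) D)
                              (∉-others (pos x) C) (∉-others (neg x) D))
          (↭-reflexive (sym (cong₂ (λ C′ D′ → C′ ∷ D′ ∷ Θ) (lit-∨-others (pos x) C x∈C)
                                                         (lit-∨-others (neg x) D x∈D))))
          (↭-reflexive (sym (cong (_++ Θ)
            (filter-accept isClause? (IsClause-antitone resolvent⊑P P-clause)))))
  ◅ done ↭-refl
  where
  as = others (pos x) C
  bs = others (neg x) D

  resolvent⊑P : ⋁ as ∨ ⋁ bs ⊑ P
  resolvent⊑P = ∨-lub (others-⊑-drop (pos x) C C⊑) (others-⊑-drop (neg x) D D⊑)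

-- Decision trees and their simulation

-- Decision trees below a path clause P, which collects the literals falsified
-- on the way from the root. A leaf carries the index of an axiom.
data DecisionTree {n : ℕ} (m : ℕ) (P : Disj n) : Set where
  leaf  : Fin m → DecisionTree m P
  query : ∀ x → IsClause (P ∨ lit (pos x)) → IsClause (P ∨ lit (neg x)) →
          DecisionTree m (P ∨ lit (pos x)) → DecisionTree m (P ∨ lit (neg x)) →
          DecisionTree m P

leaves : DecisionTree m P → ℕ
leaves (leaf _)          = 1
leaves (query _ _ _ S T) = leaves S + leaves T

-- A set, not a multiset: one copy of each axiom is supplied at the root, however many leaves carry
-- it.
used : DecisionTree m P → Subset m
used (leaf i)          = ⁅ i ⁆
used (query _ _ _ S T) = used S ∪ used T

-- The labelling `f` is kept apart from the tree, because weakenings change the clauses while the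
-- tree stays fixed.
Fits : ∀ {P : Disj n} → (Fin m → Disj n) → DecisionTree m P → Set
Fits {P = P} f (leaf i)          = f i ⊑ P
Fits         f (query _ _ _ S T) = Fits f S × Fits f T

-- Path clauses grow downwards, so the one at a leaf carrying `i` contains both `f i` and `P`, and
-- it has no complementary pair.
used-compatible : ∀ {P : Disj n} (T : DecisionTree m P) {f} → Fits f T → IsClause P →
  ∀ {i} → i Subset.∈ used T → IsClause (f i ∨ P)
used-compatible {P = P} (leaf j) fits P-clause i∈ with refl ← x∈⁅y⁆⇒x≡y j i∈ =
  IsClause-antitone (∨-lub fits λ _ → id) P-clause
used-compatible {P = P} (query x c₁ c₂ S T) {f} (fitsS , fitsT) _ {i} i∈
  with x∈p∪q⁻ (used S) (used T) i∈
... | inj₁ i∈S = IsClause-antitone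
  (∨-lub (⊑-∨ˡ (f i) (P ∨ lit (pos x)))
         λ l → ⊑-∨ʳ (f i) (P ∨ lit (pos x)) l ∘ ⊑-∨ˡ P (lit (pos x)) l)
  (used-compatible S fitsS c₁ i∈S)
... | inj₂ i∈T = IsClause-antitone
  (∨-lub (⊑-∨ˡ (f i) (P ∨ lit (neg x)))
         λ l → ⊑-∨ʳ (f i) (P ∨ lit (neg x)) l ∘ ⊑-∨ˡ P (lit (neg x)) l)
  (used-compatible T fitsT c₂ i∈T)

weakenOn : Subset m → Literal n → (Fin m → Disj n) → Fin m → Disj n
weakenOn p l f i = if Vec.lookup p i then f i ∨ lit l else f i

-- A literal of `P` lies in every path clause further down, so adding it to a label does no harm.
weakenOn-fits : ∀ (p : Subset m) (l : Literal n) {f} {P : Disj n} (T : DecisionTree m P) →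
  l ∈ᴸ P → Fits f T → Fits (weakenOn p l f) T
weakenOn-fits p l (leaf i) l∈P fits with Vec.lookup p i
... | true  = ∨-lub fits (lit-⊑ l l∈P)
... | false = fits
weakenOn-fits p l {P = P} (query x _ _ S T) l∈P (fitsS , fitsT) =
  weakenOn-fits p l S (⊑-∨ˡ P (lit (pos x)) l l∈P) fitsS ,
  weakenOn-fits p l T (⊑-∨ˡ P (lit (neg x)) l l∈P) fitsT

select : Subset m → (Fin m → Disj n) → List (Disj n)
select []          f = []
select (true ∷ p)  f = f zero ∷ select p (f ∘ suc)
select (false ∷ p) f = select p (f ∘ suc)

-- Counts the clauses around `split-run`: each of its weakenings adds one.
∣p∣+∣q∣≡∣p∩q∣+∣p∪q∣ : ∀ (p q : Subset m) → ∣ p ∣ + ∣ q ∣ ≡ ∣ p ∩ q ∣ + ∣ p ∪ q ∣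
∣p∣+∣q∣≡∣p∩q∣+∣p∪q∣ [] [] = refl
∣p∣+∣q∣≡∣p∩q∣+∣p∪q∣ (true ∷ p) (true ∷ q)
  rewrite ℕ.+-suc ∣ p ∣ ∣ q ∣ | ℕ.+-suc ∣ p ∩ q ∣ ∣ p ∪ q ∣ =
  cong (λ k → suc (suc k)) (∣p∣+∣q∣≡∣p∩q∣+∣p∪q∣ p q)
∣p∣+∣q∣≡∣p∩q∣+∣p∪q∣ (true ∷ p) (false ∷ q)
  rewrite ℕ.+-suc ∣ p ∩ q ∣ ∣ p ∪ q ∣ = cong suc (∣p∣+∣q∣≡∣p∩q∣+∣p∪q∣ p q)
∣p∣+∣q∣≡∣p∩q∣+∣p∪q∣ (false ∷ p) (true ∷ q)
  rewrite ℕ.+-suc ∣ p ∣ ∣ q ∣ | ℕ.+-suc ∣ p ∩ q ∣ ∣ p ∪ q ∣ =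
  cong suc (∣p∣+∣q∣≡∣p∩q∣+∣p∪q∣ p q)
∣p∣+∣q∣≡∣p∩q∣+∣p∪q∣ (false ∷ p) (false ∷ q) = ∣p∣+∣q∣≡∣p∩q∣+∣p∪q∣ p q

-- An axiom wanted on both sides is weakened once, giving one copy to each; an axiom wanted on one
-- side goes there unchanged.
split-run : ∀ x (p q : Subset m) (f : Fin m → Disj n) →
  (∀ {i} → i Subset.∈ p → i Subset.∈ q →
    IsClause (f i ∨ lit (pos x)) × IsClause (f i ∨ lit (neg x))) →
  select (p ∪ q) f ⟶[ ∣ p ∩ q ∣ ]
  select p (weakenOn (p ∩ q) (pos x) f) ++ select q (weakenOn (p ∩ q) (neg x) f)
split-run x [] [] f free = done ↭-refl
split-run x (true ∷ p) (true ∷ q) f free =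
  uncurry (weakening-step (f zero) x _) (free Vec.here Vec.here) ◅
  run-respʳ (run-frameˡ (_ ∷ _ ∷ []) (split-run x p q (f ∘ suc)
              λ i∈p i∈q → free (Vec.there i∈p) (Vec.there i∈q)))
            (prep _ (↭-sym (shift _ (select p _) _)))
split-run x (true ∷ p) (false ∷ q) f free =
  run-frameˡ [ f zero ] (split-run x p q (f ∘ suc)
    λ i∈p i∈q → free (Vec.there i∈p) (Vec.there i∈q))
split-run x (false ∷ p) (true ∷ q) f free =
  run-respʳ (run-frameˡ [ f zero ] (split-run x p q (f ∘ suc)
              λ i∈p i∈q → free (Vec.there i∈p) (Vec.there i∈q)))
            (↭-sym (shift (f zero) (select p _) _))
split-run x (false ∷ p) (false ∷ q) f free =
  split-run x p q (f ∘ suc) λ i∈p i∈q → free (Vec.there i∈p) (Vec.there i∈q)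

select-⁅⁆ : ∀ i (f : Fin m → Disj n) → select ⁅ i ⁆ f ≡ [ f i ]
select-⁅⁆ {m = suc m} zero f = cong (f zero ∷_) (select-⊥ m (f ∘ suc))
  where
  select-⊥ : ∀ m (f : Fin m → Disj n) → select Subset.⊥ f ≡ []
  select-⊥ zero    f = refl
  select-⊥ (suc m) f = select-⊥ m (f ∘ suc)
select-⁅⁆ (suc i) f = select-⁅⁆ i (f ∘ suc)

-- Isolates the axioms found at leaves; the rest of `F` is carried through the run as a frame.
select-partition : ∀ (F : List (Disj n)) (p : Subset (length F)) →
  F ↭ select p (lookup F) ++ select (∁ p) (lookup F)
select-partition []      []          = ↭-refl
select-partition (C ∷ F) (true ∷ p)  = prep C (select-partition F p)
select-partition (C ∷ F) (false ∷ p) =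
  ↭-trans (prep C (select-partition F p)) (↭-sym (shift C (select p (lookup F)) _))

-- The two strict hypotheses leave a slack of two: one unit pays for the resolution counted by `j`,
-- the other keeps the conclusion strict.
simulation-bound : ∀ a b w k₁ k₂ j u u₁ u₂ →
  k₁ + u₁ < 2 * a → k₂ + u₂ < 2 * b → j ≤ 1 → u₁ + u₂ ≡ w + u →
  (w + (k₁ + (k₂ + j))) + u < 2 * (a + b)
simulation-bound a b w k₁ k₂ j u u₁ u₂ h₁ h₂ j≤1 eq = begin-strict
  (w + (k₁ + (k₂ + j))) + u         ≡⟨ lhs w k₁ k₂ j u ⟩
  (w + u) + (k₁ + k₂) + j           ≡⟨ cong (λ z → z + (k₁ + k₂) + j) (sym eq) ⟩
  (u₁ + u₂) + (k₁ + k₂) + j         <⟨ s≤s (ℕ.+-monoʳ-≤ (u₁ + u₂ + (k₁ + k₂)) j≤1) ⟩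
  suc ((u₁ + u₂) + (k₁ + k₂) + 1)   ≡⟨ rhs k₁ k₂ u₁ u₂ ⟩
  suc (k₁ + u₁) + suc (k₂ + u₂)     ≤⟨ ℕ.+-mono-≤ h₁ h₂ ⟩
  2 * a + 2 * b                     ≡⟨ sym (ℕ.*-distribˡ-+ 2 a b) ⟩
  2 * (a + b)                       ∎
  where
  open ℕ.≤-Reasoning
  lhs : ∀ w k₁ k₂ j u → (w + (k₁ + (k₂ + j))) + u ≡ (w + u) + (k₁ + k₂) + j
  lhs = solve-∀
  rhs : ∀ k₁ k₂ u₁ u₂ → suc ((u₁ + u₂) + (k₁ + k₂) + 1) ≡ suc (k₁ + u₁) + suc (k₂ + u₂)
  rhs = solve-∀

-- Weakening an axiom at a query where both subtrees use it creates one more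
-- clause, and every selected clause ends at a leaf of its own; counting the
-- selected clauses on the left makes the bound inductive.
simulation : ∀ {P : Disj n} (T : DecisionTree m P) f → Fits f T → IsClause P →
  ∃[ k ] k + ∣ used T ∣ < 2 * leaves T ×
  ∃[ E ] E ⊑ P × ∃[ Δ ] (select (used T) f ⟶[ k ] E ∷ Δ)
simulation (leaf i) f fits _ rewrite ∣⁅x⁆∣≡1 i =
  -- The bound reads `0 + 1 < 2` here, with nothing to spare.
  0 , ≤-refl , f i , fits , [] , done (↭-reflexive (select-⁅⁆ i f))
simulation {P = P} (query x c₁ c₂ S T) f (fitsS , fitsT) P-clause
  with k₁ , bound₁ , C , C⊑ , Δ₁ , run₁ ← simulation S (weakenOn (used S ∩ used T) (pos x) f)
         (weakenOn-fits (used S ∩ used T) (pos x) S (∈-∨lit P (pos x)) fitsS) c₁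
     | k₂ , bound₂ , D , D⊑ , Δ₂ , run₂ ← simulation T (weakenOn (used S ∩ used T) (neg x) f)
         (weakenOn-fits (used S ∩ used T) (neg x) T (∈-∨lit P (neg x)) fitsT) c₂
  with j , j≤1 , E , E⊑ , Δ , run ← resolution-run x (Δ₁ ++ Δ₂) P-clause C⊑ D⊑
  = w + (k₁ + (k₂ + j)) ,
    simulation-bound (leaves S) (leaves T) w k₁ k₂ j _ _ _ bound₁ bound₂ j≤1
      (∣p∣+∣q∣≡∣p∩q∣+∣p∪q∣ (used S) (used T)) ,
    E , E⊑ , Δ ,
    -- Each subtree runs with the clauses of the other as frame; then `D` is moved next to `C` for
    -- the resolution.
    run-trans (split-run x (used S) (used T) f free)
   (run-trans (run-frameʳ _ run₁)
   (run-trans (run-frameˡ (C ∷ Δ₁) run₂)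
              (run-respˡ (prep C (shift D Δ₁ Δ₂)) run)))
  where
  w = ∣ used S ∩ used T ∣

  f-⊑ : ∀ l i → f i ∨ lit l ⊑ f i ∨ P ∨ lit l
  f-⊑ l i = ∨-lub (⊑-∨ˡ (f i) (P ∨ lit l))
                  λ l′ → ⊑-∨ʳ (f i) (P ∨ lit l) l′ ∘ ⊑-∨ʳ P (lit l) l′

  -- A leaf in `S` excludes `neg x` from `f i` and a leaf in `T` excludes `pos x`, so neither
  -- weakened copy is tautologous.
  free : ∀ {i} → i Subset.∈ used S → i Subset.∈ used T →
    IsClause (f i ∨ lit (pos x)) × IsClause (f i ∨ lit (neg x))
  free {i} i∈S i∈T =
    IsClause-antitone (f-⊑ (pos x) i) (used-compatible S fitsS c₁ i∈S) ,
    IsClause-antitone (f-⊑ (neg x) i) (used-compatible T fitsT c₂ i∈T)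

-- Resolving on a variable of the path clause follows the premise it satisfies;
-- hence no variable is queried twice.
decisionTree : ∀ {F : List (Disj n)} {C P} (T : TreeRes F C) → C ⊑ P → IsClause P →
  ∃[ T′ ] Fits {P = P} (lookup F) T′ × leaves T′ ≤ nodes T
decisionTree (axiom C∈F) C⊑P _ =
  leaf (index C∈F) , subst (_⊑ _) (lookup-index C∈F) C⊑P , ≤-refl
decisionTree {P = P} (weaken {C} l _ T) C⊑P P-clause
  with T′ , fits , bound ← decisionTree T (λ l′ → C⊑P l′ ∘ ⊑-∨ˡ C (lit l) l′) P-clause
  = T′ , fits , ℕ.m≤n⇒m≤1+n bound
decisionTree {P = P} (resolve {C} {D} x _ _ _ S T) C∨D⊑P P-clause
  with pos x ∈ᴸ? P | neg x ∈ᴸ? P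
... | yes x∈P | _
  with S′ , fits , bound ← decisionTree S
         (∨-lub (λ l → C∨D⊑P l ∘ ⊑-∨ˡ C D l) (lit-⊑ (pos x) x∈P)) P-clause
  = S′ , fits , ℕ.m≤n⇒m≤1+n (≤-trans bound (ℕ.m≤m+n _ _))
... | _ | yes x∈P
  with T′ , fits , bound ← decisionTree T
         (∨-lub (λ l → C∨D⊑P l ∘ ⊑-∨ʳ C D l) (lit-⊑ (neg x) x∈P)) P-clause
  = T′ , fits , ℕ.m≤n⇒m≤1+n (≤-trans bound (ℕ.m≤n+m _ _))
... | no x∉P | no x̄∉P
  with S′ , fitsS , boundS ← decisionTree S
         (∨lit-mono (pos x) λ l → C∨D⊑P l ∘ ⊑-∨ˡ C D l) (IsClause-∨lit (pos x) x̄∉P P-clause)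
     | T′ , fitsT , boundT ← decisionTree T
         (∨lit-mono (neg x) λ l → C∨D⊑P l ∘ ⊑-∨ʳ C D l) (IsClause-∨lit (neg x) x∉P P-clause)
  = query x (IsClause-∨lit (pos x) x̄∉P P-clause) (IsClause-∨lit (neg x) x∉P P-clause) S′ T′ ,
    (fitsS , fitsT) , ℕ.m≤n⇒m≤1+n (ℕ.+-mono-≤ boundS boundT)

□-isClause : IsClause (□ {n})
□-isClause (_ , x∈⊥ , _) = ∉⊥ x∈⊥

maxRes-simulates-treeRes : ∀ {F : List (Disj n)} (T : TreeRes F □) →
  ∃[ R ] steps {Γ = F} R ≤ 2 * nodes T
maxRes-simulates-treeRes {F = F} T
  with T′ , fits , leaves≤nodes ← decisionTree T (λ _ → id) □-isClause
  with k , bound , E , E⊑□ , Δ , run ← simulation T′ (lookup F) fits □-isClause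
  with R , steps≡k ← refutation
         (run-respˡ (select-partition F (used T′)) (run-frameʳ _ run))
         (here (sym (⊑□⇒≡□ E⊑□)))
  = R , (begin
    steps R                ≡⟨ steps≡k ⟩
    k                      ≤⟨ ℕ.m≤m+n k _ ⟩
    k + ∣ used T′ ∣        ≤⟨ ℕ.<⇒≤ bound ⟩
    2 * leaves T′          ≤⟨ ℕ.*-monoʳ-≤ 2 leaves≤nodes ⟩
    2 * nodes T            ∎)
  where open ℕ.≤-Reasoning

-- Completeness of tree-like resolution

_⊨ˡ?_ : ∀ (v : Assignment n) l → Dec (v ⊨ˡ l)
v ⊨ˡ? pos x = v x Bool.≟ true
v ⊨ˡ? neg x = v x Bool.≟ false

anyLiteral? : ∀ {P : Literal n → Set} → Decidable P → Dec (∃ P)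
anyLiteral? P? =
  map′ [ (λ { (x , p) → pos x , p }) , (λ { (x , p) → neg x , p }) ]′
       (λ { (pos x , p) → inj₁ (x , p) ; (neg x , p) → inj₂ (x , p) })
       (any? (P? ∘ pos) ⊎-dec any? (P? ∘ neg))

anyDisj? : ∀ {P : Disj n → Set} → Decidable P → Dec (∃ P)
anyDisj? P? =
  map′ (λ { (p , q , r) → ⟨ p ∣ q ⟩ , r }) (λ { (⟨ p ∣ q ⟩ , r) → p , q , r })
       (anySubset? λ p → anySubset? λ q → P? ⟨ p ∣ q ⟩)

_⊨?_ : ∀ (v : Assignment n) C → Dec (v ⊨ C)
v ⊨? C = anyLiteral? λ l → (l ∈ᴸ? C) ×-dec (v ⊨ˡ? l)

-- True exactly on the variables occurring negatively, so all literals of a clause `P` become false;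
-- variables absent from `P` default to false.
falsifier : Disj n → Assignment n
falsifier P x = Vec.lookup (negative P) x

-- When `P` mentions every variable, its falsifier makes each literal outside `P` true, so a
-- falsified `C` has none.
falsified⇒⊑ : ∀ {P C : Disj n} → (∀ x → pos x ∈ᴸ P ⊎ neg x ∈ᴸ P) →
  ¬ (falsifier P ⊨ C) → C ⊑ P
falsified⇒⊑ {P = P} total ¬⊨C (pos x) x∈C =
  [ id , (λ x∈P → contradiction (pos x , x∈C , []=⇒lookup x∈P) ¬⊨C) ]′ (total x)
falsified⇒⊑ {P = P} total ¬⊨C (neg x) x∈C with Vec.lookup (negative P) x in eq
... | true  = lookup⇒[]= x (negative P) eq
... | false = contradiction (neg x , x∈C , eq) ¬⊨C

-- Semantic tree: `xs` lists the variables still to be branched on. Once it is empty, `P` mentions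
-- every variable and contains an axiom that its falsifier violates. Asking only for `C ⊑ P` avoids
-- weakening.
treeRes-below : ∀ {F : List (Disj n)} → Unsatisfiable F → ∀ xs P →
  (∀ x → x ∈ xs ⊎ pos x ∈ᴸ P ⊎ neg x ∈ᴸ P) → IsClause P →
  ∃[ C ] C ⊑ P × TreeRes F C
treeRes-below {F = F} unsat [] P total P-clause =
  lookup F (index falsified) ,
  falsified⇒⊑ (λ x → [ (λ ()) , id ]′ (total x)) (lookup-index falsified) ,
  axiom (∈-lookup (index falsified))
  where
  falsified : Any (λ C → ¬ (falsifier P ⊨ C)) F
  falsified = ¬All⇒Any¬ (falsifier P ⊨?_) F (unsat (falsifier P))
treeRes-below {F = F} unsat (x ∷ xs) P total P-clause with pos x ∈ᴸ? P | neg x ∈ᴸ? P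
... | yes x∈P | _ = treeRes-below unsat xs P
  (λ y → [ (λ { (here refl) → inj₂ (inj₁ x∈P) ; (there y∈) → inj₁ y∈ }) , inj₂ ]′ (total y))
  P-clause
... | _ | yes x∈P = treeRes-below unsat xs P
  (λ y → [ (λ { (here refl) → inj₂ (inj₂ x∈P) ; (there y∈) → inj₁ y∈ }) , inj₂ ]′ (total y))
  P-clause
... | no x∉P | no x̄∉P = combine
  (treeRes-below unsat xs (P ∨ lit (pos x)) (extend (pos x) (inj₁ (∈-∨lit P (pos x))))
    (IsClause-∨lit (pos x) x̄∉P P-clause))
  (treeRes-below unsat xs (P ∨ lit (neg x)) (extend (neg x) (inj₂ (∈-∨lit P (neg x))))
    (IsClause-∨lit (neg x) x∉P P-clause))
  where
  extend : ∀ l → pos x ∈ᴸ P ∨ lit l ⊎ neg x ∈ᴸ P ∨ lit l →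
    ∀ y → y ∈ xs ⊎ pos y ∈ᴸ P ∨ lit l ⊎ neg y ∈ᴸ P ∨ lit l
  extend l x∈ y with total y
  ... | inj₁ (here refl) = inj₂ x∈
  ... | inj₁ (there y∈)  = inj₁ y∈
  ... | inj₂ y∈P         = inj₂ (Sum.map (⊑-∨ˡ P (lit l) (pos y)) (⊑-∨ˡ P (lit l) (neg y)) y∈P)

  -- A premise without its pivot literal already fits `P` and is returned as it is.
  combine : (∃[ C ] C ⊑ P ∨ lit (pos x) × TreeRes F C) →
            (∃[ D ] D ⊑ P ∨ lit (neg x) × TreeRes F D) → ∃[ E ] E ⊑ P × TreeRes F E
  combine (C , C⊑ , S) (D , D⊑ , T) with pos x ∈ᴸ? C | neg x ∈ᴸ? D
  ... | no x∉C | _ = C , ⊑-drop (pos x) x∉C C⊑ , S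
  ... | _ | no x∉D = D , ⊑-drop (neg x) x∉D D⊑ , T
  ... | yes x∈C | yes x∈D =
    _ , resolvent⊑P ,
    resolve x (∉ᴸ-others (pos x) C) (∉ᴸ-others (neg x) D) (IsClause-antitone resolvent⊑P P-clause)
      (subst (TreeRes F) (sym (others-∨-lit (pos x) C x∈C)) S)
      (subst (TreeRes F) (sym (others-∨-lit (neg x) D x∈D)) T)
    where
    resolvent⊑P : ⋁ (others (pos x) C) ∨ ⋁ (others (neg x) D) ⊑ P
    resolvent⊑P = ∨-lub (others-⊑-drop (pos x) C C⊑) (others-⊑-drop (neg x) D D⊑)

treeRes-complete : ∀ {F : List (Disj n)} → Unsatisfiable F → TreeRes F □
treeRes-complete {n = n} {F = F} unsat
  with C , C⊑□ , T ← treeRes-below unsat (allFin n) □ (inj₁ ∘ ∈-allFin) □-isClause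
  = subst (TreeRes F) (⊑□⇒≡□ C⊑□) T

-- Existence of the minimum sizes

-- Decidability makes the least size constructive: descend from `r₀` to smaller attained sizes until
-- none is left.
minimum : ∀ {R : Set} (size : R → ℕ) → (∀ k → Dec (∃[ r ] size r ≡ k)) → R →
  ∃[ k ] IsMinimum size k
minimum {R} size attained? r₀ = descend r₀ (<-wellFounded (size r₀))
  where
  descend : ∀ r → Acc _<_ (size r) → ∃[ k ] IsMinimum size k
  descend r (acc smaller) with anyUpTo? attained? (size r)
  ... | yes (k , k<r , r′ , refl) = descend r′ (smaller k<r)
  ... | no none = size r , (r , refl) , λ r′ → ≮⇒≥ λ r′<r → none (size r′ , r′<r , r′ , refl)

-- There are finitely many disjunctions over `n` variables, hence finitely many candidates for the
-- last inference, and its premises have smaller derivations.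
treeRes-size? : ∀ (F : List (Disj n)) C k → Dec (∃[ T ] nodes {F = F} {C = C} T ≡ k)
treeRes-size? {n = n} F C k = bounded k k ≤-refl C
  where
  HasSize : ℕ → Disj n → Set
  HasSize k C = ∃[ T ] nodes {F = F} {C = C} T ≡ k

  -- Here `k` excludes the last node. In `LastResolve`, `i` splits `k` between the two premises.
  LastResolve LastWeaken : ℕ → Disj n → Set
  LastResolve k E =
    ∃[ x ] ∃[ C ] ∃[ D ] pos x ∉ᴸ C × neg x ∉ᴸ D × IsClause (C ∨ D) × C ∨ D ≡ E ×
    ∃[ i ] HasSize (toℕ {suc k} i) (C ∨ lit (pos x)) × HasSize (k ∸ toℕ i) (D ∨ lit (neg x))
  LastWeaken k E = ∃[ l ] ∃[ C ] IsClause (C ∨ lit l) × C ∨ lit l ≡ E × HasSize k C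

  build : ∀ {k E} → ((k ≡ 0 × E ∈ F) ⊎ LastResolve k E ⊎ LastWeaken k E) → HasSize (suc k) E
  build (inj₁ (refl , E∈F)) = axiom E∈F , refl
  build (inj₂ (inj₁ (x , C , D , x∉C , x∉D , c , refl , i , (S , eqS) , (T , eqT)))) =
    resolve x x∉C x∉D c S T ,
    cong suc (≡-trans (cong₂ _+_ eqS eqT) (ℕ.m+[n∸m]≡n (toℕ≤pred[n] i)))
  build (inj₂ (inj₂ (l , C , c , refl , T , eqT))) = weaken l c T , cong suc eqT

  analyse : ∀ {k E} → HasSize (suc k) E → (k ≡ 0 × E ∈ F) ⊎ LastResolve k E ⊎ LastWeaken k E
  analyse (axiom E∈F , refl) = inj₁ (refl , E∈F)
  analyse (resolve {C} {D} x x∉C x∉D c S T , refl) =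
    inj₂ (inj₁ (x , C , D , x∉C , x∉D , c , refl , fromℕ< S≤ ,
      (S , sym toℕ≡) ,
      (T , sym (≡-trans (cong (nodes S + nodes T ∸_) toℕ≡) (ℕ.m+n∸m≡n (nodes S) (nodes T))))))
    where
    S≤ : nodes S < suc (nodes S + nodes T)
    S≤ = s≤s (ℕ.m≤m+n _ _)
    toℕ≡ = toℕ-fromℕ< S≤
  analyse (weaken {C} l c T , refl) = inj₂ (inj₂ (l , C , c , refl , T , refl))

  -- The premise sizes `toℕ i` and `k ∸ toℕ i` are not structurally smaller, so the recursion is on
  -- the bound `b`.
  bounded : ∀ b k → k ≤ b → ∀ E → Dec (HasSize k E)
  bounded b zero _ E =
    no λ { (axiom _ , ()) ; (resolve _ _ _ _ _ _ , ()) ; (weaken _ _ _ , ()) }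
  bounded (suc b) (suc k) (s≤s k≤b) E = map′ build analyse
    (((k ℕ.≟ 0) ×-dec Any.any? (E ≟ᴰ_) F) ⊎-dec
     (any? λ x → anyDisj? λ C → anyDisj? λ D →
       ¬? (pos x ∈ᴸ? C) ×-dec ¬? (neg x ∈ᴸ? D) ×-dec isClause? (C ∨ D) ×-dec (C ∨ D ≟ᴰ E) ×-dec
       any? λ i → bounded b (toℕ i) (≤-trans (toℕ≤pred[n] i) k≤b) (C ∨ lit (pos x)) ×-dec
                  bounded b (k ∸ toℕ i) (≤-trans (ℕ.m∸n≤m k (toℕ i)) k≤b) (D ∨ lit (neg x))) ⊎-dec
     (anyLiteral? λ l → anyDisj? λ C →
       isClause? (C ∨ lit l) ×-dec (C ∨ lit l ≟ᴰ E) ×-dec bounded b k k≤b C))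

-- Exhaustive search for MaxSAT runs

module _ {A : Set} where

  -- Pigeonhole: delete the head of `xs` from `ys`; by uniqueness the tail still embeds in what
  -- remains.
  Unique-⊆⇒length≤ : ∀ {xs ys : List A} → Unique xs → (∀ {x} → x ∈ xs → x ∈ ys) →
    length xs ≤ length ys
  Unique-⊆⇒length≤ [] _ = z≤n
  Unique-⊆⇒length≤ {x ∷ xs} (x∉xs ∷ unique) xs⊆ys
    with us , vs , refl ← ∈-∃++ (xs⊆ys (here refl)) = begin
    suc (length xs)            ≤⟨ s≤s (Unique-⊆⇒length≤ unique rest) ⟩
    suc (length (us ++ vs))    ≡⟨ ↭-length (↭-sym (shift x us vs)) ⟩
    length (us ++ x ∷ vs)      ∎
    where
    open ℕ.≤-Reasoning
    rest : ∀ {y} → y ∈ xs → y ∈ us ++ vs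
    rest y∈xs with ∈-resp-↭ (shift x us vs) (xs⊆ys (there y∈xs))
    ... | here refl = contradiction refl (All.lookup x∉xs y∈xs)
    ... | there y∈  = y∈

-- A duplicate-free list is no longer than `literals n`, so lists up to that length suffice.
anyUnique? : ∀ {P : List (Literal n) → Set} → Decidable P → Dec (∃[ ls ] Unique ls × P ls)
anyUnique? {n = n} P? =
  map′ (λ { (ls , _ , u , p) → ls , u , p })
       (λ { (ls , u , p) → ls , Unique-⊆⇒length≤ u (λ {l} _ → ∈-literals l) , u , p })
       (bounded (length (literals n)) λ ls → unique? ls ×-dec P? ls)
  where
  open UniqueDec _≟ᴸ_ using (unique?)
  bounded : ∀ {Q : List (Literal n) → Set} b → Decidable Q → Dec (∃[ ls ] length ls ≤ b × Q ls)
  bounded zero Q? = map′ (λ q → [] , z≤n , q) (λ { ([] , _ , q) → q }) (Q? [])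
  bounded (suc b) Q? =
    map′ [ (λ q → [] , z≤n , q) , (λ { (l , ls , ls≤ , q) → l ∷ ls , s≤s ls≤ , q }) ]′
         (λ { ([] , _ , q) → inj₁ q ; (l ∷ ls , s≤s ls≤ , q) → inj₂ (l , ls , ls≤ , q) })
         (Q? [] ⊎-dec anyLiteral? λ l → bounded b (Q? ∘ (l ∷_)))

anyRule? : ∀ {Q : List (Disj n) → List (Disj n) → Set} → (∀ as cs → Dec (Q as cs)) →
  Dec (∃[ as ] ∃[ cs ] MaxSATRule as cs × Q as cs)
anyRule? Q? = map′
  [ (λ { (A , x , q) → _ , _ , weakening A x , q })
  , (λ { (x , as , u , bs , u′ , x∉as , x∉bs , q) →
        _ , _ , resolution x as bs u u′ x∉as x∉bs , q }) ]′
  (λ { (_ , _ , weakening A x , q) → inj₁ (A , x , q)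
     ; (_ , _ , resolution x as bs u u′ x∉as x∉bs , q) →
         inj₂ (x , as , u , bs , u′ , x∉as , x∉bs , q) })
  ((anyDisj? λ A → any? λ x → Q? _ _) ⊎-dec
   (any? λ x → anyUnique? λ as → anyUnique? λ bs →
     ¬? (Any.any? (pos x ≟ᴸ_) as) ×-dec ¬? (Any.any? (neg x ≟ᴸ_) bs) ×-dec Q? _ _))

++-cancelˡ-↭ : ∀ {A : Set} (xs : List A) {ys zs} → xs ++ ys ↭ xs ++ zs → ys ↭ zs
++-cancelˡ-↭ []       p = p
++-cancelˡ-↭ (x ∷ xs) p = ++-cancelˡ-↭ xs (drop-∷ p)

-- Equal clauses are interchangeable, so removing the first occurrence found involves no
-- backtracking.
complement? : ∀ (as Γ : List (Disj n)) → Dec (∃[ Θ ] Γ ↭ as ++ Θ)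
complement? []       Γ = yes (Γ , ↭-refl)
complement? (A ∷ as) Γ with Any.any? (A ≟ᴰ_) Γ
... | no A∉Γ = no λ { (_ , p) → A∉Γ (∈-resp-↭ (↭-sym p) (here refl)) }
... | yes A∈Γ with us , vs , refl ← ∈-∃++ A∈Γ =
  map′ (λ { (Θ , p) → Θ , ↭-trans (shift A us vs) (prep A p) })
       (λ { (Θ , p) → Θ , drop-∷ (↭-trans (↭-sym (shift A us vs)) p) })
       (complement? as (us ++ vs))

-- The first step, or the membership of `□`, absorbs the permutation.
maxRes-resp-↭ : Γ ↭ Δ → ∃[ R ] steps {Γ = Γ} R ≡ k → ∃[ R ] steps {Γ = Δ} R ≡ k
maxRes-resp-↭ Γ↭Δ (stop □∈Γ , eq) = stop (∈-resp-↭ Γ↭Δ □∈Γ) , eq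
maxRes-resp-↭ Γ↭Δ (step s R , eq) = step (⟶-respˡ (↭-sym Γ↭Δ) s) R , eq

-- Induction on `k`: the first step has finitely many rule instances to try.
maxRes-size? : ∀ (Γ : List (Disj n)) k → Dec (∃[ R ] steps {Γ = Γ} R ≡ k)
maxRes-size? Γ zero =
  map′ (λ □∈Γ → stop □∈Γ , refl) (λ { (stop □∈Γ , _) → □∈Γ }) (Any.any? (□ ≟ᴰ_) Γ)
maxRes-size? {n = n} Γ (suc k) = map′ build analyse (anyRule? applicable?)
  where
  HasSize : List (Disj n) → Set
  HasSize Δ = ∃[ R ] steps {Γ = Δ} R ≡ k

  Applicable : List (Disj n) → List (Disj n) → Set
  Applicable as cs = ∃[ Θ ] Γ ↭ as ++ Θ × HasSize (filter isClause? cs ++ Θ)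

  -- All choices of Θ are permutations of each other, so testing one suffices.
  applicable? : ∀ as cs → Dec (Applicable as cs)
  applicable? as cs with complement? as Γ
  ... | no none = no λ { (Θ , p , _) → none (Θ , p) }
  ... | yes (Θ , p) =
    map′ (λ r → Θ , p , r)
         (λ { (Θ′ , p′ , r) → maxRes-resp-↭
           (++⁺ˡ (filter isClause? cs) (++-cancelˡ-↭ as (↭-trans (↭-sym p′) p))) r })
         (maxRes-size? (filter isClause? cs ++ Θ) k)

  build : (∃[ as ] ∃[ cs ] MaxSATRule as cs × Applicable as cs) → ∃[ R ] steps {Γ = Γ} R ≡ suc k
  build (_ , _ , rule , Θ , p , R , eq) = step (apply Θ rule p ↭-refl) R , cong suc eq

  analyse : ∃[ R ] steps {Γ = Γ} R ≡ suc k → ∃[ as ] ∃[ cs ] MaxSATRule as cs × Applicable as cs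
  analyse (step (apply Θ rule p q) R , eq) =
    _ , _ , rule , Θ , p , maxRes-resp-↭ q (R , ℕ.suc-injective eq)

lemma3p1 : ∀ {n : ℕ} (F : List (Disj n)) → IsCNF F → Unsatisfiable F →
    ∃[ m ] ∃[ t ] (IsMaxResWSize F m × IsTreeResSize F t × m ≤ 2 * t)
lemma3p1 F _ unsat
  with t , (T , refl) , t-min ← minimum nodes (treeRes-size? F □) (treeRes-complete unsat)
  -- `R` simulates a smallest tree; it both starts the search for `m` and bounds it.
  with R , R≤ ← maxRes-simulates-treeRes T
  with m , attained , m-min ← minimum steps (maxRes-size? F) R
  = m , t , (attained , m-min) , ((T , refl) , t-min) , ≤-trans (m-min R) R≤
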